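{- Let $n\ge1$ and let $(u,v,t)\in\mathcal R_n^3$ be a critical triple, i.e. $u\not\triangleleft v$ and $v\not\triangleleft t$. Then, after either of the two initial rewriting steps $$\alpha_{u,v}1_{r_t}\colon r_ur_vr_t\Rightarrow\mathcal R(N(uv))\,r_t,\qquad 1_{r_u}\alpha_{v,t}\colon r_ur_vr_t\Rightarrow r_u\,\mathcal R(N(vt))$$ (called the left and right branch, respectively), the resulting word reaches the normal form $\operatorname{NF}(u,v,t):=\mathcal R(N(uvt))$ in at most two further rewriting steps of $\Sigma^{\mathrm{row}}(n)$. Moreover: (i) the normal form $\operatorname{NF}(u,v,t)$ has at most three rows (i.e. is a product of at most three generators $r_w$); (ii) if $N(uv)$ has one row, then the left branch reaches the normal form in exactly one further step; (iii) if $N(vt)$ has one row, then the right branch reaches the normal form in at most one further step; (iv) if both $N(uv)$ and $N(vt)$ have one row, then the normal form has one row.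
   Context: Fix $n\geq1$, $[n]=\{1<2<\cdots<n\}$. For a word $w$ over $[n]$, $\mathrm{supp}(w)$ is its set of letters. A row is a nonempty strictly increasing word over $[n]$, identified with its support; $\mathcal R_n$ is the set of rows. For rows $u,v$, $u\triangleleft v$ means $\mathrm{supp}(u)\subseteq\mathrm{supp}(v)$ and $\min(v)<\min(u)$. An $N$-tableau $T$ is a finite sequence of rows $u_k,\dots,u_1$ (top to bottom) with $u_{i+1}\triangleleft u_i$ for all $i$; $\mathcal R(T):=r_{u_k}\cdots r_{u_1}$ is its row-generator reading. Right $N$-insertion of a letter $x$: insert $x$ in the bottom row $u_1$, i.e. replace $u_1$ by the row with support $\mathrm{supp}(u_1)\cup\{x\}$; if $u_1$ has a letter $>x$, the smallest such letter $y$ is bumped (it also stays in the row) and is inserted in the same way into the next row above, and so on; a letter bumped from the top row creates a new top row consisting of that letter. For a word $w$, $N(w)$ is obtained by inserting its letters from left to right starting from the empty tableau (inserting $x$ in the empty tableau gives the one-row tableau $x$). For rows $u,v$, $N(uv)$ has at most two rows. $\Sigma^{\mathrm{row}}(n)$ is the rewriting system on words in the symbols $r_u$, $u\in\mathcal R_n$, with rules $\alpha_{u,v}\colon r_ur_v\Rightarrow\mathcal R(N(uv))$ for all rows $u,v$ with $u\not\triangleleft v$. A rewriting step is the application of one rule to a factor of a word. The system is known to be convergent, its normal forms being the words $\mathcal R(T)$, $T$ an $N$-tableau; $\mathcal R(N(uvt))$ is the normal form of $r_ur_vr_t$. -}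

module Defs where

open import Data.Fin.Base using (Fin; _<_; _≤_)
open import Data.Fin.Properties using (<-cmp; _<?_)
open import Data.List.Base
  using (List; []; _∷_; [_]; _++_; length; reverse; foldl; find)
open import Data.List.Membership.Propositional using (_∈_)
open import Data.List.NonEmpty.Base as List⁺ using (List⁺; _∷_; _∷⁺_; toList)
open import Data.List.Properties using (++-identityʳ)
open import Data.List.Relation.Binary.Subset.Propositional using (_⊆_)
open import Data.List.Relation.Unary.Any using (here; there)
open import Data.List.Relation.Unary.Linked using (Linked; []; [-]; _∷_)
open import Data.Maybe.Base using (Maybe; just; nothing; maybe′)
open import Data.Nat.Base as ℕ using (ℕ; suc)
import Data.Nat.Properties as ℕ
open import Data.Product.Base using (_×_; _,_; ∃-syntax)
open import Function.Base using (flip)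
open import Relation.Binary.Definitions using (tri<; tri≈; tri>)
open import Relation.Binary.PropositionalEquality
  using (_≡_; refl; subst)
open import Relation.Nullary using (¬_; yes; no)
open import Relation.Unary using (Decidable)

private
  variable
    n : ℕ

-- The ordered alphabet [n] = {1 < ⋯ < n} is Fin n.  The proof field is
-- irrelevant, so rows with the same letters are propositionally equal.
record Row (n : ℕ) : Set where
  constructor row
  field
    word        : List⁺ (Fin n)
    .increasing : Linked _<_ (toList word)

open Row public

letters : Row n → List (Fin n)
letters u = toList (word u)

-- The first letter is the least one because the word is increasing.
min : Row n → Fin n
min u = List⁺.head (word u)

infix 4 _◁_

_◁_ : Row n → Row n → Set
u ◁ v = letters u ⊆ letters v × min v < min u

-- The increasing word with support supp w ∪ {x}, for increasing w.
insert : Fin n → List (Fin n) → List⁺ (Fin n)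
insert x []       = x ∷ []
insert x (y ∷ ys) with <-cmp x y
... | tri< _ _ _ = x ∷ y ∷ ys
... | tri≈ _ _ _ = y ∷ ys
... | tri> _ _ _ = y ∷⁺ insert x ys

insert-increasing : ∀ (x : Fin n) {w} → Linked _<_ w →
                    Linked _<_ (toList (insert x w))
insert-increasing x {[]}     _   = [-]
insert-increasing x {y ∷ ys} inc with <-cmp x y
... | tri< x<y _ _ = x<y ∷ inc
... | tri≈ _   _ _ = inc
... | tri> _ _ y<x = above y<x inc
  where
  above : ∀ {y ys} → y < x → Linked _<_ (y ∷ ys) →
          Linked _<_ (y ∷ toList (insert x ys))
  above y<x [-] = y<x ∷ [-]
  above {ys = z ∷ zs} y<x (y<z ∷ inc) with <-cmp x z
  ... | tri< x<z _ _ = y<x ∷ x<z ∷ inc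
  ... | tri≈ _   _ _ = y<z ∷ inc
  ... | tri> _ _ z<x = y<z ∷ above z<x inc

singleton : Fin n → Row n
singleton x = row (x ∷ []) [-]

insertRow : Fin n → Row n → Row n
insertRow x (row w inc) =
  row (insert x (toList w)) (insert-increasing x inc)

-- The smallest letter of u greater than x, which is the first such letter.
bumped : Fin n → Row n → Maybe (Fin n)
bumped x u = find (x <?_) (letters u)

-- Rows are listed from bottom to top here, u₁ first.
insertRows : Fin n → List (Row n) → List (Row n)
insertRows x []       = singleton x ∷ []
insertRows x (u ∷ us) =
  insertRow x u ∷ maybe′ (λ y → insertRows y us) us (bumped x u)

∈-insert : ∀ (x : Fin n) w → x ∈ toList (insert x w)
∈-insert x []       = here refl
∈-insert x (y ∷ ys) with <-cmp x y
... | tri< _ _    _ = here refl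
... | tri≈ _ refl _ = here refl
... | tri> _ _    _ = there (∈-insert x ys)

⊆-insert : ∀ (x : Fin n) w → w ⊆ toList (insert x w)
⊆-insert x (y ∷ ys) z∈w with <-cmp x y
... | tri< _ _ _ = there z∈w
... | tri≈ _ _ _ = z∈w
⊆-insert x (y ∷ ys) (here z≡y)   | tri> _ _ _ = here z≡y
⊆-insert x (y ∷ ys) (there z∈ys) | tri> _ _ _ = there (⊆-insert x ys z∈ys)

insert-⊆ : ∀ (x : Fin n) w {W} → x ∈ W → w ⊆ W → toList (insert x w) ⊆ W
insert-⊆ x []       x∈W w⊆W (here refl) = x∈W
insert-⊆ x (y ∷ ys) x∈W w⊆W z∈ with <-cmp x y
insert-⊆ x (y ∷ ys) x∈W w⊆W (here refl) | tri< _ _ _ = x∈W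
insert-⊆ x (y ∷ ys) x∈W w⊆W (there z∈)  | tri< _ _ _ = w⊆W z∈
... | tri≈ _ _ _ = w⊆W z∈
insert-⊆ x (y ∷ ys) x∈W w⊆W (here refl) | tri> _ _ _ = w⊆W (here refl)
insert-⊆ x (y ∷ ys) x∈W w⊆W (there z∈)  | tri> _ _ _ =
  insert-⊆ x ys x∈W (λ p → w⊆W (there p)) z∈

insertRow-min≤x : ∀ (x : Fin n) u → min (insertRow x u) ≤ x
insertRow-min≤x x (row (y ∷ ys) _) with <-cmp x y
... | tri< _ _    _   = ℕ.≤-refl
... | tri≈ _ refl _   = ℕ.≤-refl
... | tri> _ _    y<x = ℕ.<⇒≤ y<x

insertRow-min≤min : ∀ (x : Fin n) u → min (insertRow x u) ≤ min u
insertRow-min≤min x (row (y ∷ ys) _) with <-cmp x y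
... | tri< x<y _ _ = ℕ.<⇒≤ x<y
... | tri≈ _   _ _ = ℕ.≤-refl
... | tri> _   _ _ = ℕ.≤-refl

<-min-insertRow : ∀ (x : Fin n) u {a : Fin n} → a < x → a < min u →
                  a < min (insertRow x u)
<-min-insertRow x (row (y ∷ ys) _) a<x a<y with <-cmp x y
... | tri< _ _ _ = a<x
... | tri≈ _ _ _ = a<y
... | tri> _ _ _ = a<y

find-just : ∀ {A : Set} {P : A → Set} (P? : Decidable P) xs {y} →
            find P? xs ≡ just y → y ∈ xs × P y
find-just P? (z ∷ xs) eq   with P? z
find-just P? (z ∷ xs) refl | yes Pz = here refl , Pz
find-just P? (z ∷ xs) eq   | no  _  with find-just P? xs eq
... | y∈xs , Py = there y∈xs , Py

insertRows-linked : ∀ (x : Fin n) {us} → Linked (flip _◁_) us →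
                    Linked (flip _◁_) (insertRows x us)
insertRows-linked x {[]}     _ = [-]
insertRows-linked {n} x {u ∷ us} l with bumped x u in eq
... | nothing = keep l
  where
  keep : ∀ {us} → Linked (flip _◁_) (u ∷ us) →
         Linked (flip _◁_) (insertRow x u ∷ us)
  keep [-]           = [-]
  keep ((s , m) ∷ l) =
    ((λ p → ⊆-insert x (letters u) (s p)) ,
     ℕ.≤-<-trans (insertRow-min≤min x u) m) ∷ l
... | just y with find-just (x <?_) (letters u) eq
... | y∈u , x<y = go l
  where
  u′ : Row n
  u′ = insertRow x u

  y∈u′ : y ∈ letters u′
  y∈u′ = ⊆-insert x (letters u) y∈u

  min<y : min u′ < y
  min<y = ℕ.≤-<-trans (insertRow-min≤x x u) x<y

  go : ∀ {us} → Linked (flip _◁_) (u ∷ us) →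
       Linked (flip _◁_) (u′ ∷ insertRows y us)
  go [-] = ((λ { (here refl) → y∈u′ }) , min<y) ∷ [-]
  go (_∷_ {y = v} (s , m) l) =
    (insert-⊆ y (letters v) y∈u′ (λ p → ⊆-insert x (letters u) (s p)) ,
     <-min-insertRow y v min<y
       (ℕ.≤-<-trans (insertRow-min≤min x u) m))
    ∷ insertRows-linked y l

-- rows = u₁ ∷ ⋯ ∷ u_k ∷ [], from bottom to top.
record Tableau (n : ℕ) : Set where
  constructor tableau
  field
    rows    : List (Row n)
    .linked : Linked (flip _◁_) rows

open Tableau public

height : Tableau n → ℕ
height T = length (rows T)

∅ : Tableau n
∅ = tableau [] []

infixl 5 _←_

_←_ : Tableau n → Fin n → Tableau n
tableau us l ← x = tableau (insertRows x us) (insertRows-linked x l)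

N : List (Fin n) → Tableau n
N = foldl _←_ ∅

-- The generator r_u is represented by the row u itself.
GenWord : ℕ → Set
GenWord n = List (Row n)

-- Readings go from top to bottom: r_{u_k} ⋯ r_{u₁}.
ℛ : Tableau n → GenWord n
ℛ T = reverse (rows T)

data Rule {n : ℕ} : GenWord n → GenWord n → Set where
  α : ∀ u v → ¬ (u ◁ v) → Rule (u ∷ v ∷ []) (ℛ (N (letters u ++ letters v)))

infix 4 _⟹_ _⟹[_]_ _⟹≤[_]_

data _⟹_ {n : ℕ} : GenWord n → GenWord n → Set where
  step : ∀ l r {a b} → Rule a b → l ++ a ++ r ⟹ l ++ b ++ r

data _⟹[_]_ {n : ℕ} : GenWord n → ℕ → GenWord n → Set where
  done : ∀ {w} → w ⟹[ 0 ] w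
  _◅_  : ∀ {w w′ z k} → w ⟹ w′ → w′ ⟹[ k ] z → w ⟹[ suc k ] z

_⟹≤[_]_ : GenWord n → ℕ → GenWord n → Set
w ⟹≤[ m ] z = ∃[ k ] (k ℕ.≤ m × w ⟹[ k ] z)

NF : Row n → Row n → Row n → GenWord n
NF u v t = ℛ (N (letters u ++ letters v ++ letters t))

leftBranch : Row n → Row n → Row n → GenWord n
leftBranch u v t = ℛ (N (letters u ++ letters v)) ++ [ t ]

rightBranch : Row n → Row n → Row n → GenWord n
rightBranch u v t = u ∷ ℛ (N (letters v ++ letters t))

leftBranch-step : ∀ (u v t : Row n) → ¬ (u ◁ v) →
                  u ∷ v ∷ t ∷ [] ⟹ leftBranch u v t
leftBranch-step u v t u⋪v = step [] [ t ] (α u v u⋪v)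

rightBranch-step : ∀ (u v t : Row n) → ¬ (v ◁ t) →
                   u ∷ v ∷ t ∷ [] ⟹ rightBranch u v t
rightBranch-step u v t v⋪t =
  subst (λ w → u ∷ v ∷ t ∷ [] ⟹ u ∷ w) (++-identityʳ _)
    (step [ u ] [] (α v t v⋪t))

{-# OPTIONS --safe #-}
module Submission where

open import Defs
open import Data.Empty using (⊥-elim)
open import Data.Fin.Base using (Fin; _<_) renaming (_≤_ to _≤ᶠ_)
import Data.Fin.Properties as Fin
open import Data.List.Base
  using (List; _∷_; []; [_]; _++_; length; foldl; filter; find; reverse)
import Data.List.Extrema as Extrema
open import Data.List.Membership.Propositional using (_∈_; _∉_; lose)
  renaming (find to find∈)
open import Data.List.Membership.Propositional.Properties
  using (∈-++⁺ˡ; ∈-++⁺ʳ; ∈-++⁻; ∈-filter⁺; ∈-filter⁻)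
import Data.List.NonEmpty.Base as List⁺
open import Data.List.Properties
  using (++-assoc; ++-identityʳ; foldl-++; reverse-++; length-++)
open import Data.List.Relation.Binary.Subset.Propositional using (_⊆_)
open import Data.List.Relation.Binary.Subset.Propositional.Properties
  using (++⁺; ++⁺ˡ; ++⁺ʳ)
open import Data.List.Relation.Unary.All as All using (All; []; _∷_)
open import Data.List.Relation.Unary.Any using (here; there; any?)
open import Data.List.Relation.Unary.AllPairs as AllPairs
  using (AllPairs; []; _∷_)
import Data.List.Relation.Unary.Linked as Linked
import Data.List.Relation.Unary.Linked.Properties as Linked
open import Data.Maybe.Base using (just; nothing; maybe′)
open import Data.Nat.Base using (ℕ; _+_; _≤_; z≤n)
import Data.Nat.Properties as ℕ
open import Data.Product.Base using (_×_; _,_; proj₁; proj₂; ∃-syntax)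
open import Data.Sum.Base using (_⊎_; inj₁; inj₂; [_,_]′)
open import Function.Base using (id; _∘_; flip)
open import Relation.Binary.PropositionalEquality
  using (_≡_; refl; sym; trans; cong; cong₂; subst; subst₂; module ≡-Reasoning)
open import Relation.Nullary using (¬_; Dec; yes; no; recompute)
open import Relation.Nullary.Decidable using (_×-dec_; _→-dec_; map′)
open import Relation.Unary using (Decidable)

-- Inserting the set c into the row a makes it a ∪ c and bumps the set
-- bump a c = {y ∈ a : some x ∈ c has y as its successor in a}; these letters
-- leave in weakly increasing order, so inserting them into an empty row bumps
-- nothing.  Hence N(uv) has rows u ∪ v and bump u v, and N(uvt) has rows
-- u ∪ v ∪ t, B₁ ∪ B₂ and bump B₁ B₂, where B₁ = bump u v and
-- B₂ = bump (u ∪ v) t.  Admitting empty sets as trivial generators, each step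
-- is (a , c) ↦ (bump a c , a ∪ c), which fixes the normal pairs a ◁ c.
--
-- The left branch (B₁ , u ∪ v , t) rewrites its last pair, then its first.
-- The right branch (u , b , v ∪ t), with b = bump v t, rewrites its first
-- pair, then its last; it reaches the same word because
-- bump u b = bump B₁ B₂ and bump (u ∪ b) (v ∪ t) = B₁ ∪ B₂.

private
  variable
    n : ℕ
    a a′ c c′ u v t : List (Fin n)
    x y z : Fin n

  module Order {n} = Extrema (Fin.≤-totalOrder n)

-- Lists as finite sets

infix 4 _≐_

-- Lists stand for their sets of letters, with `++` as union; `⟪⟫-cong` turns this equivalence into
-- equality of generators.
_≐_ : List (Fin n) → List (Fin n) → Set
a ≐ c = a ⊆ c × c ⊆ a

≐-sym : a ≐ c → c ≐ a
≐-sym (f , g) = g , f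

≐-trans : a ≐ c → c ≐ u → a ≐ u
≐-trans (f , g) (f′ , g′) = (λ p → f′ (f p)) , λ p → g (g′ p)

++-cong-≐ : a ≐ a′ → c ≐ c′ → a ++ c ≐ a′ ++ c′
++-cong-≐ (f , g) (f′ , g′) = ++⁺ f f′ , ++⁺ g g′

≐-reflexive : a ≡ c → a ≐ c
≐-reflexive refl = id , id

∄∈⇒≡[] : {A : Set} {xs : List A} → (∀ {x} → x ∉ xs) → xs ≡ []
∄∈⇒≡[] {xs = []}    none = refl
∄∈⇒≡[] {xs = _ ∷ _} none = ⊥-elim (none (here refl))

-- Successors and bumped sets

least : {P : Fin n → Set} → Decidable P → y ∈ a → P y →
        ∃[ m ] (m ∈ a × P m × (∀ {z} → z ∈ a → P z → m ≤ᶠ z))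
least {y = y} {a = a} P? y∈a Py =
  m , proj₁ m∈ , proj₂ m∈ ,
  λ z∈a Pz → All.lookup (Order.min≤xs y _) (∈-filter⁺ P? z∈a Pz)
  where
  -- The default `y` is itself a candidate, so the minimum stays among the candidates even if it is
  -- `y`.
  m = Order.min y (filter P? a)
  m∈ = Order.argmin-all id (y∈a , Py) (All.tabulate (∈-filter⁻ P?))

greatest : {P : Fin n → Set} → Decidable P → y ∈ a → P y →
           ∃[ m ] (m ∈ a × P m × (∀ {z} → z ∈ a → P z → z ≤ᶠ m))
greatest {y = y} {a = a} P? y∈a Py =
  m , proj₁ m∈ , proj₂ m∈ ,
  λ z∈a Pz → All.lookup (Order.xs≤max y _) (∈-filter⁺ P? z∈a Pz)
  where
  m = Order.max y (filter P? a)
  m∈ = Order.argmax-all id (y∈a , Py) (All.tabulate (∈-filter⁻ P?))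

-- Kept apart from `Succ` because this part passes to subsets and to unions.
Gap : List (Fin n) → Fin n → Fin n → Set
Gap a x y = ∀ {z} → z ∈ a → x < z → y ≤ᶠ z

Succ : List (Fin n) → Fin n → Fin n → Set
Succ a x y = y ∈ a × x < y × Gap a x y

gap? : ∀ (a : List (Fin n)) x y → Dec (Gap a x y)
gap? a x y = map′ (λ f z∈a → All.lookup f z∈a) (λ g → All.tabulate g)
  (All.all? (λ z → (x Fin.<? z) →-dec (y Fin.≤? z)) a)

succ-exists : y ∈ a → x < y → ∃[ z ] Succ a x z
succ-exists {x = x} y∈a x<y = least (x Fin.<?_) y∈a x<y

succ-unique : Succ a x y → Succ a x z → y ≡ z
succ-unique (y∈ , x<y , gy) (z∈ , x<z , gz) =
  Fin.≤-antisym (gy z∈ x<z) (gz y∈ x<y)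

gap-⊆ : c ⊆ a → Gap a x y → Gap c x y
gap-⊆ c⊆a g z∈c = g (c⊆a z∈c)

gap-++ : Gap a x y → Gap c x y → Gap (a ++ c) x y
gap-++ {a = a} g g′ z∈ with ∈-++⁻ a z∈
... | inj₁ z∈a = g z∈a
... | inj₂ z∈c = g′ z∈c

gap-narrow : x ≤ᶠ z → Gap a x y → Gap a z y
gap-narrow x≤z g w∈a z<w = g w∈a (ℕ.≤-<-trans x≤z z<w)

bump : List (Fin n) → List (Fin n) → List (Fin n)
bump a c = filter (λ y → any? (λ x → (x Fin.<? y) ×-dec gap? a x y) c) a

∈-bump⁺ : x ∈ c → Succ a x y → y ∈ bump a c
∈-bump⁺ x∈c (y∈a , s) = ∈-filter⁺ _ y∈a (lose x∈c s)

∈-bump⁻ : ∀ a c → y ∈ bump a c → ∃[ x ] (x ∈ c × Succ {n} a x y)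
∈-bump⁻ a c p
  with ∈-filter⁻ (λ y → any? (λ x → (x Fin.<? y) ×-dec gap? a x y) c) p
... | y∈a , q with find∈ q
... | x , x∈c , s = x , x∈c , y∈a , s

bump-⊆ : ∀ a c → bump {n} a c ⊆ a
bump-⊆ a c p = proj₁ (proj₂ (proj₂ (∈-bump⁻ a c p)))

-- More inserted letters can only bump more, but enlarging the row could put a letter into a gap;
-- hence an equivalence on the left.
bump-mono : a ≐ a′ → c ⊆ c′ → bump a c ⊆ bump a′ c′
bump-mono {a = a} {c = c} (f , g) h p with ∈-bump⁻ a c p
... | x , x∈c , y∈a , x<y , gap =
  ∈-bump⁺ (h x∈c) (f y∈a , x<y , gap-⊆ g gap)

bump-congˡ : ∀ (c : List (Fin n)) → a ≐ a′ → bump a c ≐ bump a′ c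
bump-congˡ c e = bump-mono {c = c} e id , bump-mono {c = c} (≐-sym e) id

bump-congʳ : ∀ (a : List (Fin n)) → c ≐ c′ → bump a c ≐ bump a c′
bump-congʳ a (f , g) =
  bump-mono {a = a} (id , id) f , bump-mono {a = a} (id , id) g

bump-[] : ∀ (a : List (Fin n)) → bump a [] ≡ []
bump-[] a = ∄∈⇒≡[] λ p → case p
  where
  case : y ∉ bump a []
  case p with ∈-bump⁻ a [] p
  ... | _ , () , _

-- Otherwise `x` would have a successor in `a`, and that letter would be bumped.
bump≡[]⇒≤ : bump a c ≡ [] → y ∈ a → x ∈ c → y ≤ᶠ x
bump≡[]⇒≤ {a = a} {c = c} e y∈a x∈c = ℕ.≮⇒≥ λ x<y →
  absurd (∈-bump⁺ {c = c} x∈c (proj₂ (succ-exists y∈a x<y)))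
  where
  absurd : y ∉ bump a c
  absurd p with () ← subst (_ ∈_) e p

≤⇒bump≡[] : ∀ a c → (∀ {x y} → y ∈ a → x ∈ c → y ≤ᶠ x) → bump {n} a c ≡ []
≤⇒bump≡[] a c le = ∄∈⇒≡[] absurd
  where
  absurd : y ∉ bump a c
  absurd p with ∈-bump⁻ a c p
  ... | x , x∈c , y∈a , x<y , _ = ℕ.<⇒≱ x<y (le y∈a x∈c)

-- Exchange identities for bumped sets

module _ (u v t : List (Fin n)) where

  private
    b = bump v t

  -- The set bumped by the last step of the right branch is the middle row of the normal form. A
  -- letter may be bumped by different letters on the two sides.
  bump-exchange-middle :
    bump (u ++ b) (v ++ t) ≐ bump u v ++ bump (u ++ v) t
  bump-exchange-middle = to , from
    where
    b⊆v : b ⊆ v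
    b⊆v = bump-⊆ v t

    to : bump (u ++ b) (v ++ t) ⊆ bump u v ++ bump (u ++ v) t
    to {y} p with ∈-bump⁻ (u ++ b) (v ++ t) p
    ... | x , x∈ , y∈ , x<y , g with ∈-++⁻ u y∈ | ∈-++⁻ v x∈
    ... | inj₁ y∈u | inj₁ x∈v =
      ∈-++⁺ˡ (∈-bump⁺ x∈v (y∈u , x<y , gap-⊆ ∈-++⁺ˡ g))
    ... | inj₁ y∈u | inj₂ x∈t
      -- A letter of `v` between `x` and `y` bumps `y` from `u`; if there is none, `y` is also the
      -- successor of `x` in `u ++ v`.
      with any? (λ z → (x Fin.<? z) ×-dec (z Fin.<? y)) v
    ... | yes q with find∈ q
    ... | z , z∈v , x<z , z<y = ∈-++⁺ˡ (∈-bump⁺ z∈v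
      (y∈u , z<y , gap-narrow (ℕ.<⇒≤ x<z) (gap-⊆ ∈-++⁺ˡ g)))
    to {y} p | x , x∈ , y∈ , x<y , g | inj₁ y∈u | inj₂ x∈t | no ¬q =
      ∈-++⁺ʳ (bump u v) (∈-bump⁺ x∈t (∈-++⁺ˡ y∈u , x<y , gap-++ {a = u}
        (gap-⊆ ∈-++⁺ˡ g)
        λ z∈v x<z → ℕ.≮⇒≥ λ z<y → ¬q (lose z∈v (x<z , z<y))))
    -- Here `s` bumps `y` from `v`. The larger of `s` and `x` bumps `y` from `u ++ v`: it lies in
    -- `t`, since an `x` in `v` above `s` would lie in the gap below `y`.
    to {y} p | x , x∈ , y∈ , x<y , g | inj₂ y∈b | x∈v⊎t with ∈-bump⁻ v t y∈b
    ... | s , s∈t , y∈v , s<y , gv with s Fin.<? x | x∈v⊎t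
    ... | no s≮x | _ = ∈-++⁺ʳ (bump u v) (∈-bump⁺ s∈t
      (∈-++⁺ʳ u y∈v , s<y ,
       gap-++ (gap-narrow (ℕ.≮⇒≥ s≮x) (gap-⊆ ∈-++⁺ˡ g)) gv))
    ... | yes s<x | inj₁ x∈v = ⊥-elim (ℕ.<⇒≱ x<y (gv x∈v s<x))
    ... | yes s<x | inj₂ x∈t = ∈-++⁺ʳ (bump u v) (∈-bump⁺ x∈t
      (∈-++⁺ʳ u y∈v , x<y ,
       gap-++ (gap-⊆ ∈-++⁺ˡ g) (gap-narrow (ℕ.<⇒≤ s<x) gv)))

    from : bump u v ++ bump (u ++ v) t ⊆ bump (u ++ b) (v ++ t)
    from {y} p with ∈-++⁻ (bump u v) p
    from {y} p | inj₁ p′ with ∈-bump⁻ u v p′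
    ... | x , x∈v , y∈u , x<y , g
      -- The greatest letter of `v` below `y` leaves no letter of `v`, hence none of `b`, in
      -- between.
      with greatest (Fin._<? y) x∈v x<y
    ... | m , m∈v , m<y , above = ∈-bump⁺ (∈-++⁺ˡ m∈v)
      (∈-++⁺ˡ y∈u , m<y , gap-++ (gap-narrow (above x∈v x<y) g)
       λ z∈b m<z → ℕ.≮⇒≥ λ z<y → ℕ.<⇒≱ m<z (above (b⊆v z∈b) z<y))
    from {y} p | inj₂ p′ with ∈-bump⁻ (u ++ v) t p′
    ... | x , x∈t , y∈ , x<y , g = ∈-bump⁺ (∈-++⁺ʳ v x∈t)
      (y∈u∪b (∈-++⁻ u y∈) , x<y ,
       gap-++ (gap-⊆ ∈-++⁺ˡ g) (gap-⊆ (∈-++⁺ʳ u ∘ b⊆v) g))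
      where
      y∈u∪b : y ∈ u ⊎ y ∈ v → y ∈ u ++ b
      y∈u∪b (inj₁ y∈u) = ∈-++⁺ˡ y∈u
      y∈u∪b (inj₂ y∈v) =
        ∈-++⁺ʳ u (∈-bump⁺ x∈t (y∈v , x<y , gap-⊆ (∈-++⁺ʳ u) g))

  -- The top rows agree: a bumping letter in `b` is traded for one in `B₂` that comes from the same
  -- letter `s` of `t`.
  bump-exchange-top : bump u b ≐ bump (bump u v) (bump (u ++ v) t)
  bump-exchange-top = to , from
    where
    to : bump u b ⊆ bump (bump u v) (bump (u ++ v) t)
    to {y} p with ∈-bump⁻ u b p
    ... | x , x∈b , y∈u , x<y , g with ∈-bump⁻ v t x∈b
    ... | s , s∈t , x∈v , s<x , gv
      -- In the larger row `u ++ v` the letter `s` bumps some `z`, at most `x`, which takes over the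
      -- role of `x`.
      with succ-exists (∈-++⁺ʳ u x∈v) s<x
    ... | z , z∈ , s<z , g′ = ∈-bump⁺ (∈-bump⁺ s∈t (z∈ , s<z , g′))
      (∈-bump⁺ x∈v (y∈u , x<y , g) , ℕ.≤-<-trans z≤x x<y , gap)
      where
      z≤x : z ≤ᶠ x
      z≤x = g′ (∈-++⁺ʳ u x∈v) s<x

      gap : Gap (bump u v) z y
      gap {w} w∈ z<w with ∈-bump⁻ u v w∈
      ... | q , q∈v , w∈u , q<w , gq with x Fin.<? w
      ... | yes x<w = g w∈u x<w
      -- If `w` is at most `x`, the letter `q` that bumps it is at most `s`. Then `z` in `u`
      -- contradicts that `w` succeeds `q`, and `z` in `v` that `x` succeeds `s`.
      ... | no  x≮w = ⊥-elim (impossible (∈-++⁻ u z∈))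
        where
        w≤x = ℕ.≮⇒≥ x≮w
        q≤s : q ≤ᶠ s
        q≤s = ℕ.≮⇒≥ λ s<q → ℕ.<⇒≱ (ℕ.<-≤-trans q<w w≤x) (gv q∈v s<q)
        impossible : ¬ (z ∈ u ⊎ z ∈ v)
        impossible (inj₁ z∈u) =
          ℕ.<⇒≱ z<w (gq z∈u (ℕ.≤-<-trans q≤s s<z))
        impossible (inj₂ z∈v) =
          ℕ.<⇒≱ (ℕ.<-≤-trans z<w w≤x) (gv z∈v s<z)

    from : bump (bump u v) (bump (u ++ v) t) ⊆ bump u b
    from {y} p with ∈-bump⁻ (bump u v) (bump (u ++ v) t) p
    ... | z , z∈B , y∈B , z<y , g
      with ∈-bump⁻ u v y∈B | ∈-bump⁻ (u ++ v) t z∈B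
    ... | q , q∈v , y∈u , q<y , gq | s , s∈t , z∈ , s<z , gs
      with v-above-z (∈-++⁻ u z∈)
      where
      v-above-z : z ∈ u ⊎ z ∈ v → ∃[ x ] (x ∈ v × z ≤ᶠ x × x < y)
      v-above-z (inj₁ z∈u) =
        q , q∈v , ℕ.≮⇒≥ (λ q<z → ℕ.<⇒≱ z<y (gq z∈u q<z)) , q<y
      v-above-z (inj₂ z∈v) = z , z∈v , ℕ.≤-refl , z<y
    -- The least letter `x` of `v` from `z` on is the successor of `s` in `v`, so it lies in `b`;
    -- the witness `r` shows that it is below `y`.
    ... | r , r∈v , z≤r , r<y with least (z Fin.≤?_) r∈v z≤r
    ... | x , x∈v , z≤x , below = ∈-bump⁺
      (∈-bump⁺ s∈t (x∈v , ℕ.<-≤-trans s<z z≤x ,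
        λ w∈v s<w → below w∈v (gs (∈-++⁺ʳ u w∈v) s<w)))
      (y∈u , ℕ.≤-<-trans (below r∈v z≤r) r<y , gap)
      where
      gap : Gap u x y
      -- The successor of `x` in `u` is itself in `bump u v` and above `z`, so it is at least `y`.
      gap w∈u x<w with succ-exists w∈u x<w
      ... | w′ , w′∈u , x<w′ , g′ = ℕ.≤-trans
        (g (∈-bump⁺ x∈v (w′∈u , x<w′ , g′)) (ℕ.≤-<-trans z≤x x<w′))
        (g′ w∈u x<w)

-- Insertion into a row

Sorted : List (Fin n) → Set
Sorted = AllPairs _≤ᶠ_

letters-increasing : (u : Row n) → AllPairs _<_ (letters u)
letters-increasing (row w w↗) =
  Linked.Linked⇒AllPairs (λ {i j k} → Fin.<-trans {i = i} {j} {k})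
    (recompute (Linked.linked? Fin._<?_ (List⁺.toList w)) w↗)

letters-sorted : (u : Row n) → Sorted (letters u)
letters-sorted u = AllPairs.map ℕ.<⇒≤ (letters-increasing u)

min-≤ : ∀ (u : Row n) → y ∈ letters u → min u ≤ᶠ y
min-≤ u (here refl) = ℕ.≤-refl
min-≤ u (there y∈) =
  ℕ.<⇒≤ (All.lookup (AllPairs.head (letters-increasing u)) y∈)

increasing-unique : AllPairs _<_ a → AllPairs _<_ c → a ≐ c → a ≡ c
increasing-unique []       []       _       = refl
increasing-unique []       (_ ∷ _)  (_ , g) with () ← g (here refl)
increasing-unique (_ ∷ _)  []       (f , _) with () ← f (here refl)
increasing-unique {a = x ∷ xs} {c = y ∷ ys} (x<xs ∷ xs↗) (y<ys ∷ ys↗) (f , g) =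
  cong₂ _∷_ x≡y (increasing-unique xs↗ ys↗
    (tail-⊆ x<xs x≡y f , tail-⊆ y<ys (sym x≡y) g))
  where
  x≡y : x ≡ y
  x≡y with f (here refl) | g (here refl)
  ... | here x≡y | _        = x≡y
  ... | there _  | here y≡x = sym y≡x
  ... | there p  | there q  =
    ⊥-elim (ℕ.<-asym (All.lookup y<ys p) (All.lookup x<xs q))

  tail-⊆ : ∀ {x y : Fin _} {xs ys} → All (x <_) xs → x ≡ y →
           x ∷ xs ⊆ y ∷ ys → xs ⊆ ys
  tail-⊆ x<xs refl f z∈ with f (there z∈)
  ... | here refl = ⊥-elim (ℕ.<-irrefl refl (All.lookup x<xs z∈))
  ... | there z∈ys = z∈ys

row-unique : {u v : Row n} → letters u ≐ letters v → u ≡ v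
row-unique {u = u} {v} e
  with increasing-unique (letters-increasing u) (letters-increasing v) e
... | refl = refl

insertWord : List (Fin n) → Row n → Row n
insertWord w u = foldl (flip insertRow) u w

insertWordRows : List (Fin n) → List (Row n) → List (Row n)
insertWordRows w us = foldl (flip insertRows) us w

bumpedWord : List (Fin n) → Row n → List (Fin n)
bumpedWord []      u = []
bumpedWord (x ∷ w) u =
  maybe′ _∷_ id (bumped x u) (bumpedWord w (insertRow x u))

-- A row acts on those above only through the letters it bumps, so all its insertions can be done
-- first.
insertWordRows-∷ : ∀ w (u : Row n) us →
  insertWordRows w (u ∷ us) ≡
  insertWord w u ∷ insertWordRows (bumpedWord w u) us
insertWordRows-∷ []      u us = refl
insertWordRows-∷ (x ∷ w) u us with bumped x u
... | nothing = insertWordRows-∷ w (insertRow x u) us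
... | just y  = insertWordRows-∷ w (insertRow x u) (insertRows y us)

letters-insertRow : ∀ x (u : Row n) → letters (insertRow x u) ≐ x ∷ letters u
letters-insertRow x u =
  insert-⊆ x (letters u) (here refl) there ,
  λ { (here refl) → ∈-insert x (letters u)
    ; (there p)   → ⊆-insert x (letters u) p }

letters-insertWord : ∀ w (u : Row n) → letters (insertWord w u) ≐ letters u ++ w
letters-insertWord []      u = ≐-reflexive (sym (++-identityʳ (letters u)))
letters-insertWord (x ∷ w) u =
  ≐-trans (letters-insertWord w (insertRow x u))
    (≐-trans (++-cong-≐ (letters-insertRow x u) (id , id))
      ((λ { (here refl) → ∈-++⁺ʳ (letters u) (here refl)
          ; (there p) → ++⁺ʳ (letters u) there p }) ,
       λ p → [ there ∘ ∈-++⁺ˡ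
             , (λ { (here refl) → here refl
                  ; (there q) → there (∈-++⁺ʳ (letters u) q) }) ]′
             (∈-++⁻ (letters u) p)))

find-nothing : {A : Set} {P : A → Set} (P? : Decidable P) (xs : List A) →
               find P? xs ≡ nothing → All (¬_ ∘ P) xs
find-nothing P? []       _ = []
find-nothing P? (x ∷ xs) e with P? x
... | no ¬Px = ¬Px ∷ find-nothing P? xs e

find-first : {P : Fin n → Set} (P? : Decidable P) → AllPairs _<_ a →
             find P? a ≡ just y →
             y ∈ a × P y × (∀ {z} → z ∈ a → P z → y ≤ᶠ z)
find-first {a = x ∷ a} P? (x<a ∷ a↗) e with P? x
find-first {a = x ∷ a} P? (x<a ∷ a↗) refl | yes Px =
  here refl , Px ,
  λ { (here refl) _ → ℕ.≤-refl
    ; (there z∈a) _ → ℕ.<⇒≤ (All.lookup x<a z∈a) }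
... | no ¬Px with find-first P? a↗ e
... | y∈a , Py , first =
  there y∈a , Py ,
  λ { (here refl) Px → ⊥-elim (¬Px Px) ; (there z∈a) → first z∈a }

bumped-succ : ∀ x (u : Row n) → bumped x u ≡ just y → Succ (letters u) x y
bumped-succ x u = find-first (x Fin.<?_) (letters-increasing u)

-- Later letters are at least `x`, so adding `x` to the row leaves the gaps above them intact.
bump-∷ : ∀ {x} (u : Row n) {w} → All (x ≤ᶠ_) w → y ∈ bump (letters u) (x ∷ w) →
         Succ (letters u) x y ⊎ y ∈ bump (letters (insertRow x u)) w
bump-∷ {x = x} u {w} x≤w p with ∈-bump⁻ (letters u) (x ∷ w) p
... | _  , here refl , s = inj₁ s
... | x′ , there x′∈w , y∈u , x′<y , g = inj₂ (∈-bump⁺ x′∈w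
  (proj₂ (letters-insertRow x u) (there y∈u) , x′<y ,
   gap-⊆ (proj₁ (letters-insertRow x u))
     λ { (here refl) x′<x → ⊥-elim (ℕ.<⇒≱ x′<x (All.lookup x≤w x′∈w))
       ; (there q) → g q }))

bump-insertRow : ∀ {x} (u : Row n) {w} → All (x ≤ᶠ_) w →
                 bump (letters (insertRow x u)) w ⊆ bump (letters u) (x ∷ w)
bump-insertRow {x = x} u {w} x≤w p with ∈-bump⁻ (letters (insertRow x u)) w p
... | x′ , x′∈w , y∈ , x′<y , g with proj₁ (letters-insertRow x u) y∈
... | here refl  = ⊥-elim (ℕ.<⇒≱ x′<y (All.lookup x≤w x′∈w))
... | there y∈u = ∈-bump⁺ (there x′∈w)
  (y∈u , x′<y , gap-⊆ (proj₂ (letters-insertRow x u) ∘ there) g)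

-- As `w` is sorted, letters already inserted never exceed the next one, which therefore bumps its
-- successor in the original row.
bumpedWord-≐ : ∀ {w} (u : Row n) → Sorted w →
               bumpedWord w u ≐ bump (letters u) w
bumpedWord-≐ u [] = ≐-reflexive (sym (bump-[] (letters u)))
bumpedWord-≐ {w = x ∷ w} u (x≤w ∷ w↗) with bumped x u in e
... | nothing =
  (λ p → bump-insertRow u x≤w (proj₁ ih p)) ,
  λ p → [ (λ (y∈u , x<y , _) →
             ⊥-elim (All.lookup (find-nothing (x Fin.<?_) (letters u) e)
               y∈u x<y))
        , proj₂ ih ]′ (bump-∷ u x≤w p)
  where
  ih = bumpedWord-≐ (insertRow x u) w↗
... | just y =
  (λ { (here refl) → ∈-bump⁺ (here refl) s
     ; (there p) → bump-insertRow u x≤w (proj₁ ih p) }) ,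
  λ p → [ (λ s′ → here (succ-unique s′ s))
        , there ∘ proj₂ ih ]′ (bump-∷ u x≤w p)
  where
  ih = bumpedWord-≐ (insertRow x u) w↗
  s : Succ (letters u) x y
  s = bumped-succ x u e

-- Successors in a fixed row increase weakly with the inserted letter. This lets the bumped word be
-- inserted into the next row by the same description.
bumpedWord-sorted : ∀ {w} (u : Row n) → Sorted w → Sorted (bumpedWord w u)
bumpedWord-sorted u [] = []
bumpedWord-sorted {w = x ∷ w} u (x≤w ∷ w↗) with bumped x u in e
... | nothing = bumpedWord-sorted (insertRow x u) w↗
... | just y  = All.tabulate y≤ ∷ bumpedWord-sorted (insertRow x u) w↗
  where
  y≤ : z ∈ bumpedWord w (insertRow x u) → y ≤ᶠ z
  y≤ p with ∈-bump⁻ (letters u) (x ∷ w)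
              (bump-insertRow u x≤w (proj₁ (bumpedWord-≐ (insertRow x u) w↗) p))
  ... | x′ , x′∈ , z∈u , x′<z , _ =
    proj₂ (proj₂ (bumped-succ x u e)) z∈u
      (ℕ.≤-<-trans (All.lookup (ℕ.≤-refl ∷ x≤w) x′∈) x′<z)

-- The word of at most one generator whose support is the set of letters of w;
-- the empty set is no row and gives the empty word.
⟪_⟫ : List (Fin n) → GenWord n
⟪ [] ⟫    = []
⟪ x ∷ w ⟫ = [ insertWord w (singleton x) ]

letters-⟪⟫ : ∀ x (w : List (Fin n)) →
             letters (insertWord w (singleton x)) ≐ x ∷ w
letters-⟪⟫ x w = letters-insertWord w (singleton x)

-- A strictly increasing word is determined by its support.
⟪⟫-cong : a ≐ c → ⟪ a ⟫ ≡ ⟪ c ⟫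
⟪⟫-cong {a = []}    {[]}    _       = refl
⟪⟫-cong {a = []}    {_ ∷ _} (_ , g) with () ← g (here refl)
⟪⟫-cong {a = _ ∷ _} {[]}    (f , _) with () ← f (here refl)
⟪⟫-cong {a = x ∷ a} {y ∷ c} e = cong [_]
  (row-unique (≐-trans (letters-⟪⟫ x a) (≐-trans e (≐-sym (letters-⟪⟫ y c)))))

insertWord-tail : (u : Row n) →
                  insertWord (List⁺.tail (word u)) (singleton (min u)) ≡ u
insertWord-tail u =
  row-unique {v = u} (letters-⟪⟫ (min u) (List⁺.tail (word u)))

⟪letters⟫ : (u : Row n) → ⟪ letters u ⟫ ≡ [ u ]
⟪letters⟫ u = cong [_] (insertWord-tail u)

length-⟪⟫ : (w : List (Fin n)) → length ⟪ w ⟫ ≤ 1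
length-⟪⟫ []      = z≤n
length-⟪⟫ (_ ∷ _) = ℕ.≤-refl

reverse-⟪⟫-++ : ∀ (w : List (Fin n)) us →
                reverse (⟪ w ⟫ ++ us) ≡ reverse us ++ ⟪ w ⟫
reverse-⟪⟫-++ []      us = sym (++-identityʳ (reverse us))
reverse-⟪⟫-++ (x ∷ w) us = reverse-++ ⟪ x ∷ w ⟫ us

reverse-⟪⟫ : (w : List (Fin n)) → reverse ⟪ w ⟫ ≡ ⟪ w ⟫
reverse-⟪⟫ []      = refl
reverse-⟪⟫ (_ ∷ _) = refl

-- All later letters are at least the first, so the row begun by it bumps nothing.
insertWordRows-[] : ∀ {w : List (Fin n)} → Sorted w →
                    insertWordRows w [] ≡ ⟪ w ⟫
insertWordRows-[] [] = refl
insertWordRows-[] {w = x ∷ w} (x≤w ∷ w↗) = begin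
  insertWordRows w [ singleton x ]
    ≡⟨ insertWordRows-∷ w (singleton x) [] ⟩
  insertWord w (singleton x) ∷ insertWordRows (bumpedWord w (singleton x)) []
    ≡⟨ cong (λ q → insertWord w (singleton x) ∷ insertWordRows q []) none ⟩
  ⟪ x ∷ w ⟫ ∎
  where
  open ≡-Reasoning
  none : bumpedWord w (singleton x) ≡ []
  none = ∄∈⇒≡[] λ p → ∉-[] (subst (_ ∈_)
    (≤⇒bump≡[] (x ∷ []) w λ { (here refl) z∈w → All.lookup x≤w z∈w })
    (proj₁ (bumpedWord-≐ (singleton x) w↗) p))
    where
    ∉-[] : z ∉ []
    ∉-[] ()

-- The bumped letters are sorted, so they form a single row on top. For empty `p` the bumped set
-- computes to the empty list.
insertWordRows-⟪⟫ : ∀ (p : List (Fin n)) {q} → Sorted q →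
                    insertWordRows q ⟪ p ⟫ ≡ ⟪ p ++ q ⟫ ++ ⟪ bump p q ⟫
insertWordRows-⟪⟫ [] {q} q↗ =
  trans (insertWordRows-[] q↗) (sym (++-identityʳ ⟪ q ⟫))
insertWordRows-⟪⟫ (x ∷ p) {q} q↗ = begin
  insertWordRows q ⟪ x ∷ p ⟫
    ≡⟨ insertWordRows-∷ q r [] ⟩
  insertWord q r ∷ insertWordRows (bumpedWord q r) []
    ≡⟨ cong₂ _∷_ (sym (foldl-++ (flip insertRow) (singleton x) p q))
         (insertWordRows-[] (bumpedWord-sorted r q↗)) ⟩
  ⟪ x ∷ p ++ q ⟫ ++ ⟪ bumpedWord q r ⟫
    ≡⟨ cong (⟪ x ∷ p ++ q ⟫ ++_) (⟪⟫-cong (≐-trans (bumpedWord-≐ r q↗)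
         (bump-congˡ q (letters-⟪⟫ x p)))) ⟩
  ⟪ x ∷ p ++ q ⟫ ++ ⟪ bump (x ∷ p) q ⟫ ∎
  where
  open ≡-Reasoning
  r = insertWord p (singleton x)

-- The tableaux N(uv) and N(uvt)

rows-N : (w : List (Fin n)) → rows (N w) ≡ insertWordRows w []
rows-N = go ∅
  where
  go : ∀ T (w : List (Fin n)) → rows (foldl _←_ T w) ≡ insertWordRows w (rows T)
  go T []      = refl
  go T (x ∷ w) = go (T ← x) w

module _ (u v : Row n) where

  private
    U = letters u
    V = letters v

  rows-N₂ : rows (N (U ++ V)) ≡ ⟪ U ++ V ⟫ ++ ⟪ bump U V ⟫
  rows-N₂ = begin
    rows (N (U ++ V))              ≡⟨ rows-N (U ++ V) ⟩
    insertWordRows (U ++ V) []     ≡⟨ foldl-++ _ [] U V ⟩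
    insertWordRows V (insertWordRows U [])
      ≡⟨ cong (insertWordRows V) (insertWordRows-[] (letters-sorted u)) ⟩
    insertWordRows V ⟪ U ⟫         ≡⟨ insertWordRows-⟪⟫ U (letters-sorted v) ⟩
    ⟪ U ++ V ⟫ ++ ⟪ bump U V ⟫     ∎
    where open ≡-Reasoning

  ℛ-N₂ : ℛ (N (U ++ V)) ≡ ⟪ bump U V ⟫ ++ ⟪ U ++ V ⟫
  ℛ-N₂ = begin
    reverse (rows (N (U ++ V)))            ≡⟨ cong reverse rows-N₂ ⟩
    reverse (⟪ U ++ V ⟫ ++ ⟪ bump U V ⟫)
      ≡⟨ reverse-⟪⟫-++ (U ++ V) ⟪ bump U V ⟫ ⟩
    reverse ⟪ bump U V ⟫ ++ ⟪ U ++ V ⟫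
      ≡⟨ cong (_++ ⟪ U ++ V ⟫) (reverse-⟪⟫ (bump U V)) ⟩
    ⟪ bump U V ⟫ ++ ⟪ U ++ V ⟫             ∎
    where open ≡-Reasoning

  -- The union `U ++ V` is nonempty and already accounts for one row.
  height-N₂ : height (N (U ++ V)) ≡ 1 → bump U V ≡ []
  height-N₂ h with bump U V | trans (cong length (sym rows-N₂)) h
  ... | []    | _  = refl
  ... | _ ∷ _ | ()

  module _ (t : Row n) where

    private
      T = letters t
      B₁ = bump U V
      B₂ = bump (U ++ V) T

    -- The letters of `t` enter the bottom row of `N(uv)`, and those they bump enter the possibly
    -- empty row `B₁`.
    NF-formula : NF u v t ≡ ⟪ bump B₁ B₂ ⟫ ++ ⟪ B₁ ++ B₂ ⟫ ++ ⟪ U ++ V ++ T ⟫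
    NF-formula = begin
      reverse (rows (N (U ++ V ++ T)))
        ≡⟨ cong reverse (trans (rows-N (U ++ V ++ T)) rows₃) ⟩
      reverse (⟪ U ++ V ++ T ⟫ ++ ⟪ B₁ ++ B₂ ⟫ ++ ⟪ bump B₁ B₂ ⟫)
        ≡⟨ reverse-⟪⟫-++ (U ++ V ++ T) (⟪ B₁ ++ B₂ ⟫ ++ ⟪ bump B₁ B₂ ⟫) ⟩
      reverse (⟪ B₁ ++ B₂ ⟫ ++ ⟪ bump B₁ B₂ ⟫) ++ ⟪ U ++ V ++ T ⟫
        ≡⟨ cong (_++ ⟪ U ++ V ++ T ⟫)
             (trans (reverse-⟪⟫-++ (B₁ ++ B₂) ⟪ bump B₁ B₂ ⟫)
               (cong (_++ ⟪ B₁ ++ B₂ ⟫) (reverse-⟪⟫ (bump B₁ B₂)))) ⟩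
      (⟪ bump B₁ B₂ ⟫ ++ ⟪ B₁ ++ B₂ ⟫) ++ ⟪ U ++ V ++ T ⟫
        ≡⟨ ++-assoc ⟪ bump B₁ B₂ ⟫ ⟪ B₁ ++ B₂ ⟫ ⟪ U ++ V ++ T ⟫ ⟩
      ⟪ bump B₁ B₂ ⟫ ++ ⟪ B₁ ++ B₂ ⟫ ++ ⟪ U ++ V ++ T ⟫ ∎
      where
      open ≡-Reasoning

      X : Row n
      X = insertWord V u

      X≐ : letters X ≐ U ++ V
      X≐ = letters-insertWord V u

      ⟪U++V⟫ : ⟪ U ++ V ⟫ ≡ [ X ]
      ⟪U++V⟫ = cong [_] (trans
        (foldl-++ (flip insertRow) (singleton (min u)) (List⁺.tail (word u)) V)
        (cong (insertWord V) (insertWord-tail u)))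

      C = bumpedWord T X

      C≐ : C ≐ B₂
      C≐ = ≐-trans (bumpedWord-≐ X (letters-sorted t)) (bump-congˡ T X≐)

      rows₃ : insertWordRows (U ++ V ++ T) [] ≡
              ⟪ U ++ V ++ T ⟫ ++ ⟪ B₁ ++ B₂ ⟫ ++ ⟪ bump B₁ B₂ ⟫
      rows₃ = begin
        insertWordRows (U ++ V ++ T) []
          ≡⟨ cong (λ w → insertWordRows w []) (++-assoc U V T) ⟨
        insertWordRows ((U ++ V) ++ T) []
          ≡⟨ foldl-++ _ [] (U ++ V) T ⟩
        insertWordRows T (insertWordRows (U ++ V) [])
          ≡⟨ cong (insertWordRows T) (trans (sym (rows-N (U ++ V))) rows-N₂) ⟩
        insertWordRows T (⟪ U ++ V ⟫ ++ ⟪ B₁ ⟫)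
          ≡⟨ cong (λ us → insertWordRows T (us ++ ⟪ B₁ ⟫)) ⟪U++V⟫ ⟩
        insertWordRows T (X ∷ ⟪ B₁ ⟫)
          ≡⟨ insertWordRows-∷ T X ⟪ B₁ ⟫ ⟩
        insertWord T X ∷ insertWordRows C ⟪ B₁ ⟫
          -- `⟪ U ++ V ++ T ⟫` unfolds to a fold from `singleton (min u)`, which is split after `U`
          -- and after `V`.
          ≡⟨ cong₂ _∷_ (sym (trans
               (foldl-++ (flip insertRow) (singleton (min u))
                 (List⁺.tail (word u)) (V ++ T))
               (trans (cong (insertWord (V ++ T)) (insertWord-tail u))
                 (foldl-++ (flip insertRow) u V T))))
               (insertWordRows-⟪⟫ B₁ (bumpedWord-sorted X (letters-sorted t))) ⟩
        ⟪ U ++ V ++ T ⟫ ++ ⟪ B₁ ++ C ⟫ ++ ⟪ bump B₁ C ⟫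
          ≡⟨ cong (⟪ U ++ V ++ T ⟫ ++_) (cong₂ _++_
               (⟪⟫-cong (++-cong-≐ {a = B₁} (id , id) C≐))
               (⟪⟫-cong (bump-congʳ B₁ C≐))) ⟩
        ⟪ U ++ V ++ T ⟫ ++ ⟪ B₁ ++ B₂ ⟫ ++ ⟪ bump B₁ B₂ ⟫ ∎

-- In a normal pair every letter of a is bumped by the letter of c preceding it.
⊆-bump : a ⊆ c → x ∈ c → (∀ {y} → y ∈ a → x < y) → a ⊆ bump a c
⊆-bump a⊆c x∈c x<a {y} y∈a with greatest (Fin._<? y) x∈c (x<a y∈a)
... | m , m∈c , m<y , above = ∈-bump⁺ m∈c (y∈a , m<y ,
  λ z∈a m<z → ℕ.≮⇒≥ λ z<y → ℕ.<⇒≱ m<z (above (a⊆c z∈a) z<y))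

-- Rewriting a pair of sets

_◁?_ : (u v : Row n) → Dec (u ◁ v)
u ◁? v = (letters u ⊆? letters v) ×-dec (min v Fin.<? min u)
  where
  open import Data.List.Relation.Binary.Subset.DecPropositional Fin._≟_
    using (_⊆?_)

rule-⟪⟫ : ∀ x a y (c : List (Fin n)) →
  ¬ (insertWord a (singleton x) ◁ insertWord c (singleton y)) →
  Rule (⟪ x ∷ a ⟫ ++ ⟪ y ∷ c ⟫)
       (⟪ bump (x ∷ a) (y ∷ c) ⟫ ++ ⟪ (x ∷ a) ++ (y ∷ c) ⟫)
rule-⟪⟫ x a y c A⋪C = subst (Rule (A ∷ C ∷ [])) (trans (ℛ-N₂ A C)
  (cong₂ _++_
    (⟪⟫-cong (≐-trans (bump-congˡ (letters C) A≐) (bump-congʳ (x ∷ a) C≐)))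
    (⟪⟫-cong (++-cong-≐ A≐ C≐))))
  (α A C A⋪C)
  where
  A = insertWord a (singleton x)
  C = insertWord c (singleton y)
  A≐ = letters-⟪⟫ x a
  C≐ = letters-⟪⟫ y c

-- The inclusion makes the union equal to the lower set, and with the inequality of minima it makes
-- the whole upper set bumped.
normal-pair : ∀ x a y (c : List (Fin n)) →
  insertWord a (singleton x) ◁ insertWord c (singleton y) →
  ⟪ x ∷ a ⟫ ++ ⟪ y ∷ c ⟫ ≡
  ⟪ bump (x ∷ a) (y ∷ c) ⟫ ++ ⟪ (x ∷ a) ++ (y ∷ c) ⟫
normal-pair x a y c (A⊆C , minC<minA) = cong₂ _++_
  (⟪⟫-cong
    ( ⊆-bump a⊆c (proj₁ C≐ (here refl))
        (λ z∈a → ℕ.<-≤-trans minC<minA (min-≤ A (proj₂ A≐ z∈a)))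
    , bump-⊆ (x ∷ a) (y ∷ c)))
  (⟪⟫-cong {a = y ∷ c} (∈-++⁺ʳ (x ∷ a) , λ p → [ a⊆c , id ]′ (∈-++⁻ (x ∷ a) p)))
  where
  A = insertWord a (singleton x)
  A≐ = letters-⟪⟫ x a
  C≐ = letters-⟪⟫ y c
  a⊆c : x ∷ a ⊆ y ∷ c
  a⊆c z∈a = proj₁ C≐ (A⊆C (proj₂ A≐ z∈a))

-- The two branches

⟹≤-reflexive : ∀ {w w′ : GenWord n} {k} → w ≡ w′ → w ⟹≤[ k ] w′
⟹≤-reflexive refl = 0 , z≤n , done

_◅◅_ : ∀ {w w′ w″ : GenWord n} {k m} →
       w ⟹[ k ] w′ → w′ ⟹[ m ] w″ → w ⟹[ k + m ] w″
done     ◅◅ q = q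
(s ◅ p)  ◅◅ q = s ◅ (p ◅◅ q)

⟹≤-trans : ∀ {w w′ w″ : GenWord n} {k m} →
            w ⟹≤[ k ] w′ → w′ ⟹≤[ m ] w″ → w ⟹≤[ k + m ] w″
⟹≤-trans (_ , i≤k , p) (_ , j≤m , q) = _ , ℕ.+-mono-≤ i≤k j≤m , p ◅◅ q

-- Empty sets and normal pairs cost no step, so one statement covers all degenerate shapes of the
-- branches.
normalise-pair : ∀ l (a c : List (Fin n)) r →
  l ++ (⟪ a ⟫ ++ ⟪ c ⟫) ++ r ⟹≤[ 1 ] l ++ (⟪ bump a c ⟫ ++ ⟪ a ++ c ⟫) ++ r
normalise-pair l []      c r = ⟹≤-reflexive refl
normalise-pair l (x ∷ a) [] r = ⟹≤-reflexive (cong (λ w → l ++ w ++ r)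
  (trans (++-identityʳ ⟪ x ∷ a ⟫)
    (sym (cong₂ (λ b d → ⟪ b ⟫ ++ ⟪ d ⟫) (bump-[] (x ∷ a))
      (++-identityʳ (x ∷ a))))))
normalise-pair l (x ∷ a) (y ∷ c) r
  with insertWord a (singleton x) ◁? insertWord c (singleton y)
... | yes A◁C =
  ⟹≤-reflexive (cong (λ w → l ++ w ++ r) (normal-pair x a y c A◁C))
... | no  A⋪C = 1 , ℕ.≤-refl , (step l r (rule-⟪⟫ x a y c A⋪C) ◅ done)

module _ (u v t : Row n) where

  private
    U = letters u
    V = letters v
    T = letters t
    B₁ = bump U V
    B₂ = bump (U ++ V) T
    b = bump V T

  leftBranch-formula : leftBranch u v t ≡ ⟪ B₁ ⟫ ++ ⟪ U ++ V ⟫ ++ [ t ]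
  leftBranch-formula = trans (cong (_++ [ t ]) (ℛ-N₂ u v)) (++-assoc ⟪ B₁ ⟫ _ _)

  left-word : GenWord n
  left-word = ⟪ B₁ ⟫ ++ ⟪ B₂ ⟫ ++ ⟪ U ++ V ++ T ⟫

  -- The merged row contains `v`, so if it were `◁ t`, then `v` would be too. Hence a rule does
  -- apply, as the exact count in (ii) requires.
  leftBranch-⟹ : ¬ (v ◁ t) → leftBranch u v t ⟹ left-word
  leftBranch-⟹ v⋪t = subst₂ _⟹_ source target
    (step ⟪ B₁ ⟫ [] (rule-⟪⟫ (min u) (List⁺.tail (word u) ++ V)
                             (min t) (List⁺.tail (word t)) X⋪t))
    where
    X = insertWord (List⁺.tail (word u) ++ V) (singleton (min u))
    X≐ : letters X ≐ U ++ V
    X≐ = letters-⟪⟫ (min u) (List⁺.tail (word u) ++ V)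

    X⋪t : ¬ (X ◁ insertWord (List⁺.tail (word t)) (singleton (min t)))
    X⋪t p with subst (X ◁_) (insertWord-tail t) p
    ... | X⊆t , mint<minX = v⋪t
      ( (λ z∈v → X⊆t (V⊆X z∈v))
      , ℕ.<-≤-trans mint<minX (min-≤ X (V⊆X (here refl))))
      where
      V⊆X : V ⊆ letters X
      V⊆X z∈v = proj₂ X≐ (∈-++⁺ʳ U z∈v)

    source : ⟪ B₁ ⟫ ++ (⟪ U ++ V ⟫ ++ ⟪ T ⟫) ++ [] ≡ leftBranch u v t
    source = trans (cong (⟪ B₁ ⟫ ++_) (trans (++-identityʳ _)
      (cong (⟪ U ++ V ⟫ ++_) (⟪letters⟫ t)))) (sym leftBranch-formula)

    target : ⟪ B₁ ⟫ ++ (⟪ B₂ ⟫ ++ ⟪ (U ++ V) ++ T ⟫) ++ [] ≡ left-word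
    target = cong (⟪ B₁ ⟫ ++_) (trans (++-identityʳ _)
      (cong (λ w → ⟪ B₂ ⟫ ++ ⟪ w ⟫) (++-assoc U V T)))

  left-word-⟹ : left-word ⟹≤[ 1 ] NF u v t
  left-word-⟹ = subst₂ _⟹≤[ 1 ]_ (++-assoc ⟪ B₁ ⟫ ⟪ B₂ ⟫ _)
    (trans (++-assoc ⟪ bump B₁ B₂ ⟫ ⟪ B₁ ++ B₂ ⟫ _) (sym (NF-formula u v t)))
    (normalise-pair [] B₁ B₂ ⟪ U ++ V ++ T ⟫)

  left-word-NF : B₁ ≡ [] → left-word ≡ NF u v t
  left-word-NF e = trans
    -- With `B₁` generalised to `p`, both sides compute to the same word at `p = []`.
    (subst (λ p → ⟪ p ⟫ ++ ⟪ B₂ ⟫ ++ ⟪ U ++ V ++ T ⟫ ≡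
                  ⟪ bump p B₂ ⟫ ++ ⟪ p ++ B₂ ⟫ ++ ⟪ U ++ V ++ T ⟫)
      (sym e) refl)
    (sym (NF-formula u v t))

  right-word : GenWord n
  right-word = ⟪ bump U b ⟫ ++ ⟪ U ++ b ⟫ ++ ⟪ V ++ T ⟫

  rightBranch-formula : rightBranch u v t ≡ ⟪ U ⟫ ++ ⟪ b ⟫ ++ ⟪ V ++ T ⟫
  rightBranch-formula = cong₂ _++_ (sym (⟪letters⟫ u)) (ℛ-N₂ v t)

  rightBranch-⟹ : rightBranch u v t ⟹≤[ 1 ] right-word
  rightBranch-⟹ = subst₂ _⟹≤[ 1 ]_
    (trans (++-assoc ⟪ U ⟫ ⟪ b ⟫ _) (sym rightBranch-formula))
    (++-assoc ⟪ bump U b ⟫ ⟪ U ++ b ⟫ _)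
    (normalise-pair [] U b ⟪ V ++ T ⟫)

  -- Inserting the empty set changes nothing, so only the second step of the right branch remains.
  rightBranch-right-word : b ≡ [] → rightBranch u v t ≡ right-word
  rightBranch-right-word e = trans rightBranch-formula
    (subst (λ p → ⟪ U ⟫ ++ ⟪ p ⟫ ++ ⟪ V ++ T ⟫ ≡
                  ⟪ bump U p ⟫ ++ ⟪ U ++ p ⟫ ++ ⟪ V ++ T ⟫)
      (sym e) (sym (cong₂ (λ p q → ⟪ p ⟫ ++ ⟪ q ⟫ ++ ⟪ V ++ T ⟫)
        (bump-[] U) (++-identityʳ U))))

  -- Rewriting the last pair yields the three rows of the normal form by the exchange identities;
  -- the bottom row agrees because `b` lies in `V`.
  right-word-⟹ : right-word ⟹≤[ 1 ] NF u v t
  right-word-⟹ = subst₂ _⟹≤[ 1 ]_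
    (cong (⟪ bump U b ⟫ ++_) (++-identityʳ (⟪ U ++ b ⟫ ++ ⟪ V ++ T ⟫)))
    (trans (cong₂ _++_ (⟪⟫-cong (bump-exchange-top U V T))
             (trans (++-identityʳ _) (cong₂ _++_
               (⟪⟫-cong (bump-exchange-middle U V T))
               (⟪⟫-cong support))))
           (sym (NF-formula u v t)))
    (normalise-pair ⟪ bump U b ⟫ (U ++ b) (V ++ T) [])
    where
    support : (U ++ b) ++ (V ++ T) ≐ U ++ V ++ T
    support =
      (λ p → [ [ ∈-++⁺ˡ , ∈-++⁺ʳ U ∘ ∈-++⁺ˡ ∘ bump-⊆ V T ]′ ∘ ∈-++⁻ U
             , ∈-++⁺ʳ U ]′ (∈-++⁻ (U ++ b) p)) ,
      ++⁺ˡ {xs = U} (V ++ T) ∈-++⁺ˡ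

  length-NF : length (NF u v t) ≤ 3
  length-NF rewrite NF-formula u v t
    | length-++ ⟪ bump B₁ B₂ ⟫ {⟪ B₁ ++ B₂ ⟫ ++ ⟪ U ++ V ++ T ⟫}
    | length-++ ⟪ B₁ ++ B₂ ⟫ {⟪ U ++ V ++ T ⟫} =
    ℕ.+-mono-≤ (length-⟪⟫ (bump B₁ B₂))
      (ℕ.+-mono-≤ (length-⟪⟫ (B₁ ++ B₂)) ℕ.≤-refl)

  length-NF≡1 : B₁ ≡ [] → b ≡ [] → length (NF u v t) ≡ 1
  length-NF≡1 e₁ e = trans (cong length (NF-formula u v t))
    (subst₂ (λ p q → length (⟪ bump p q ⟫ ++ ⟪ p ++ q ⟫ ++ ⟪ U ++ V ++ T ⟫) ≡ 1)
      (sym e₁) (sym e₂) refl)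
    where
    e₂ : B₂ ≡ []
    e₂ = ≤⇒bump≡[] (U ++ V) T λ z∈ x∈t →
      -- The first letter of `v` separates `u` from `t`.
      [ (λ z∈u → ℕ.≤-trans (bump≡[]⇒≤ e₁ z∈u (here refl))
                           (bump≡[]⇒≤ e (here refl) x∈t))
      , (λ z∈v → bump≡[]⇒≤ e z∈v x∈t) ]′ (∈-++⁻ U z∈)

proposition3p2p3 : (n : ℕ) → 1 ≤ n → (u v t : Row n) → ¬ (u ◁ v) → ¬ (v ◁ t) →
    (u ∷ v ∷ t ∷ [] ⟹ leftBranch u v t)
    × (leftBranch u v t ⟹≤[ 2 ] NF u v t)
    × (u ∷ v ∷ t ∷ [] ⟹ rightBranch u v t)
    × (rightBranch u v t ⟹≤[ 2 ] NF u v t)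
    × (length (NF u v t) ≤ 3)
    × (height (N (letters u ++ letters v)) ≡ 1 →
    leftBranch u v t ⟹[ 1 ] NF u v t)
    × (height (N (letters v ++ letters t)) ≡ 1 →
    rightBranch u v t ⟹≤[ 1 ] NF u v t)
    × (height (N (letters u ++ letters v)) ≡ 1 →
    height (N (letters v ++ letters t)) ≡ 1 →
    length (NF u v t) ≡ 1)
proposition3p2p3 n _ u v t u⋪v v⋪t =
    leftBranch-step u v t u⋪v
  , ⟹≤-trans (1 , ℕ.≤-refl , (left ◅ done)) (left-word-⟹ u v t)
  , rightBranch-step u v t v⋪t
  , ⟹≤-trans (rightBranch-⟹ u v t) (right-word-⟹ u v t)
  , length-NF u v t
  , (λ h → subst (leftBranch u v t ⟹[ 1 ]_)
             (left-word-NF u v t (height-N₂ u v h)) (left ◅ done))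
  , (λ h → subst (_⟹≤[ 1 ] NF u v t)
             (sym (rightBranch-right-word u v t (height-N₂ v t h)))
             (right-word-⟹ u v t))
  , λ h h′ → length-NF≡1 u v t (height-N₂ u v h) (height-N₂ v t h′)
  where
  left = leftBranch-⟹ u v t v⋪t
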